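{- For every integer $k\geq1$ there is a constant $C=C(k)$ such that the following holds. Let $G$ be a finite group and $A\subseteq G$ be $k$-stable. Then for every $0<\epsilon\leq\frac12$ there are a normal subgroup $H\leq G$ of index at most $\exp^{C}(\epsilon^{ -1})$ and a set $D\subseteq G$ which is a union of cosets of $H$ such that $|A\triangle D|<\epsilon|H|$.
   Context: A subset $A$ of a group $G$ is $k$-stable if there do not exist $a_1,\ldots,a_k,b_1,\ldots,b_k\in G$ with $a_ib_j\in A$ iff $i\leq j$. $\exp$ is base-$2$ exponentiation and $\exp^C$ is its $C$-fold iterate. -}

module Defs where

open import Data.Nat using (ℕ; zero; suc; _^_; _*_)
open import Data.Fin using (Fin)
import Data.Fin as F
open import Data.Fin.Subset using (Subset; _∈_; _∪_; _∩_; ∁)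
open import Data.Product using (Σ; _×_; ∃)
open import Function.Bundles using (_⇔_)
open import Relation.Nullary using (¬_)
open import Relation.Binary.PropositionalEquality using (_≡_)
open import Algebra.Core using (Op₁; Op₂)
open import Algebra.Structures using (IsGroup)
open import Data.Integer using (ℤ; ∣_∣)
open import Data.Rational using (ℚ; Positive; 1/_; ceiling)
open import Data.Rational.Properties using (pos⇒nonZero)

-- A finite group of order n, presented (w.l.o.g., up to isomorphism)
-- on the carrier Fin n with propositional equality.
record FiniteGroup (n : ℕ) : Set where
  field
    _∙_ : Op₂ (Fin n)
    e   : Fin n
    _⁻¹ : Op₁ (Fin n)
    isGroup : IsGroup _≡_ _∙_ e _⁻¹

module _ {n : ℕ} (G : FiniteGroup n) where
  open FiniteGroup G

  Stable : ℕ → Subset n → Set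
  Stable k A = ¬ (Σ (Fin k → Fin n) λ a → Σ (Fin k → Fin n) λ b →
                   ∀ (i j : Fin k) → ((a i ∙ b j) ∈ A) ⇔ (i F.≤ j))

  IsNormalSubgroup : Subset n → Set
  IsNormalSubgroup H =
    (e ∈ H)
    × (∀ x y → x ∈ H → y ∈ H → (x ∙ y) ∈ H)
    × (∀ x → x ∈ H → (x ⁻¹) ∈ H)
    × (∀ g x → x ∈ H → ((g ∙ x) ∙ (g ⁻¹)) ∈ H)

  -- D is a union of (left) cosets xH of H: whenever x ∈ D, all of xH ⊆ D.
  -- (For normal H left and right cosets coincide.)
  UnionOfCosets : Subset n → Subset n → Set
  UnionOfCosets H D = ∀ x h → x ∈ D → h ∈ H → (x ∙ h) ∈ D

_△_ : ∀ {n} → Subset n → Subset n → Subset n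
A △ D = (A ∩ ∁ D) ∪ (D ∩ ∁ A)

expIter : ℕ → ℕ → ℕ
expIter zero    m = m
expIter (suc C) m = 2 ^ expIter C m

ceilInv : (ε : ℚ) → .{{_ : Positive ε}} → ℕ
ceilInv ε = ∣ ceiling ((1/ ε) {{pos⇒nonZero ε}}) ∣

{-# OPTIONS --safe #-}
-- Split G repeatedly by right translates A y⁻¹. Full binary splitting trees yield half graphs, so
-- stability bounds the depth, and some X of density at least 1/q (with q a bounded tower in 1/ε) is
-- almost contained in or almost disjoint from every A y⁻¹, up to a proportion far below 1/q.
-- Let P be the set of y for which almost all x ∈ X have x y ∈ A. If g⁻¹ P ≠ h⁻¹ P then X g and X h
-- are almost disjoint, so P has at most q left translates, and the kernel H of the action of G on
-- these translates has index at most q ^ q. Double counting the pairs (x , y) with x ∈ X for which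
-- x y ∈ A and y ∈ P disagree gives x with A △ x P small, and x P is a union of cosets of H.
module Submission where

open import Defs
open import Algebra.Structures using (IsGroup)
open import Data.Bool using (Bool; true; false; not; _∧_; _∨_; _xor_; if_then_else_)
import Data.Bool.Properties as Bool
open import Data.Fin using (Fin; zero; suc; toℕ; opposite; inject₁; funToFin; finToFun)
open import Data.Fin.Permutation using (permutation)
open import Data.Fin.Properties
  using (opposite-prop; toℕ-inject₁; toℕ<n; all?; any?; ¬∀⟶∃¬; finToFun-funToFin) renaming (_≟_ to _≟ᶠ_)
open import Data.Fin.Subset using (Subset; ∣_∣; _∈_; _∩_; ∁)
import Data.Integer as ℤ
open import Data.Integer.DivMod using ([n/d]*d≤n)
import Data.Integer.Properties as ℤₚ
open import Data.Nat hiding (_/_)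
open import Data.Nat.Properties
open import Data.Nat.Solver using (module +-*-Solver)
open import Algebra.Properties.Semiring.Sum +-*-semiring
  using (sum; sum-cong-≗; ∑-distrib-+; ∑-comm; ∑-permute; *-distribˡ-sum)
open import Data.Product using (Σ; ∃; _×_; _,_; proj₁; proj₂)
import Data.Rational as ℚ
open import Data.Rational using (ℚ; Positive; ½; _/_) renaming (_≤_ to _≤ℚ_; _<_ to _<ℚ_)
import Data.Rational.Properties as ℚₚ
import Data.Rational.Unnormalised as ℚᵘ
import Data.Rational.Unnormalised.Properties as ℚᵘₚ
open import Data.Sum using (_⊎_; inj₁; inj₂)
open import Data.Unit using (⊤; tt)
open import Data.Vec using ([]; _∷_; lookup; tabulate)
open import Data.Vec.Properties using (lookup∘tabulate; lookup-map; lookup-zipWith; []=⇒lookup; lookup⇒[]=)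
open import Function using (_∘_; id; const; mk⇔)
open import Level using (0ℓ)
open import Relation.Binary using (Rel; Decidable)
open import Relation.Binary.PropositionalEquality
open import Relation.Nullary using (Dec; yes; no; does; ¬_; contradiction)
open import Relation.Nullary.Decidable using (dec-true; dec-false; _⊎-dec_)
open import Relation.Unary using (Pred; _⊆_)

-- Splitting trees and half graphs

module _ {X Y : Set} where

  -- `U` constrains the leaves and is refined along each branch, so a leaf realises the pattern of
  -- `R` on its path. `V` constrains all node labels and stays fixed, so that a colour of the nodes
  -- can be imposed through it.
  data Tree (R : X → Y → Bool) : Pred X 0ℓ → Pred Y 0ℓ → ℕ → Set₁ where
    leaf : ∀ {U V} x → U x → Tree R U V 0
    node : ∀ {U V d} y → V y →
           Tree R (λ x → U x × R x y ≡ true) V d →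
           Tree R (λ x → U x × R x y ≡ false) V d →
           Tree R U V (suc d)

  Tree-map : ∀ {R U U′ V V′ d} → U ⊆ U′ → V ⊆ V′ → Tree R U V d → Tree R U′ V′ d
  Tree-map f g (leaf x u)     = leaf x (f u)
  Tree-map f g (node y v s t) =
    node y (g v) (Tree-map (λ (u , r) → f u , r) g s) (Tree-map (λ (u , r) → f u , r) g t)

  someLeaf : ∀ {R U V d} → Tree R U V d → ∃ U
  someLeaf (leaf x u)     = x , u
  someLeaf (node y v s t) = let (x , u , _) = someLeaf s in x , u

  -- If the root has colour `true` and both subtrees contain a `true` tree one level lower than
  -- required, the root joins them; otherwise one subtree already contains a `false` tree of height
  -- `b`. A root of colour `false` is symmetric.
  Tree-ramsey : ∀ {R U V} (c : Y → Bool) a b → Tree R U V (a + b) →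
                Tree R U (λ y → V y × c y ≡ true) a ⊎ Tree R U (λ y → V y × c y ≡ false) b
  Tree-ramsey c zero b T = inj₁ (let (x , u) = someLeaf T in leaf x u)
  Tree-ramsey c (suc a) zero T = inj₂ (let (x , u) = someLeaf T in leaf x u)
  Tree-ramsey c (suc a) (suc b) (node y v s t) with c y in eq
  ... | true with Tree-ramsey c a (suc b) s | Tree-ramsey c a (suc b) t
  ...   | inj₁ s′ | inj₁ t′ = inj₁ (node y (v , eq) s′ t′)
  ...   | inj₂ s′ | _       = inj₂ (Tree-map (λ (u , _) → u) id s′)
  ...   | inj₁ _  | inj₂ t′ = inj₂ (Tree-map (λ (u , _) → u) id t′)
  Tree-ramsey {R} {U} {V} c (suc a) (suc b) (node {d = d} y v s t) | false
    with Tree-ramsey c (suc a) b (subst (Tree R _ _) (+-suc a b) s)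
       | Tree-ramsey c (suc a) b (subst (Tree R _ _) (+-suc a b) t)
  ...   | inj₂ s′ | inj₂ t′ = inj₂ (node y (v , eq) s′ t′)
  ...   | inj₁ s′ | _       = inj₁ (Tree-map (λ (u , _) → u) id s′)
  ...   | inj₂ _  | inj₁ t′ = inj₁ (Tree-map (λ (u , _) → u) id t′)

  record HalfGraph (R : X → Y → Bool) (U : Pred X 0ℓ) (V : Pred Y 0ℓ) (m : ℕ) : Set where
    constructor halfGraph
    field
      a      : Fin m → X
      b      : Fin m → Y
      a∈U    : ∀ i → U (a i)
      b∈V    : ∀ j → V (b j)
      Rab⇔≤ᵇ : ∀ i j → R (a i) (b j) ≡ (toℕ i ≤ᵇ toℕ j)

  HalfGraph-[] : ∀ {R U V} → HalfGraph R U V 0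
  HalfGraph-[] = halfGraph (λ ()) (λ ()) (λ ()) (λ ()) (λ ())

  HalfGraph-map : ∀ {R U U′ V V′ m} → U ⊆ U′ → V ⊆ V′ → HalfGraph R U V m → HalfGraph R U′ V′ m
  HalfGraph-map f g (halfGraph a b u v r) = halfGraph a b (λ i → f (u i)) (λ j → g (v j)) r

  suc-≤ᵇ : ∀ i j → (i ≤ᵇ j) ≡ (i <ᵇ suc j)
  suc-≤ᵇ zero    j = refl
  suc-≤ᵇ (suc i) j = refl

  -- The new pair gets index 0: `x` must be related to every later `b`, since 0 ≤ j, and `y` to no
  -- later `a`, since i ≤ 0 fails for them.
  HalfGraph-∷ : ∀ {R U V m} x y → U x → V y → R x y ≡ true →
                HalfGraph R (λ x′ → U x′ × R x′ y ≡ false) (λ y′ → V y′ × R x y′ ≡ true) m →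
                HalfGraph R U V (suc m)
  HalfGraph-∷ {R} {U} {V} {m} x y ux vy rxy (halfGraph a b u v r) = halfGraph a′ b′ u′ v′ r′
    where
    a′ : Fin (suc m) → X
    a′ zero    = x
    a′ (suc i) = a i
    b′ : Fin (suc m) → Y
    b′ zero    = y
    b′ (suc j) = b j
    u′ : ∀ i → U (a′ i)
    u′ zero    = ux
    u′ (suc i) = let (p , _) = u i in p
    v′ : ∀ j → V (b′ j)
    v′ zero    = vy
    v′ (suc j) = let (p , _) = v j in p
    r′ : ∀ i j → R (a′ i) (b′ j) ≡ (toℕ i ≤ᵇ toℕ j)
    r′ zero    zero    = rxy
    r′ zero    (suc j) = let (_ , p) = v j in p
    r′ (suc i) zero    = let (_ , p) = u i in p
    r′ (suc i) (suc j) = trans (r i j) (suc-≤ᵇ (toℕ i) (toℕ j))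

-- The summands are the heights asked of `Tree-ramsey` in the two colours. Each exceeds a recursive
-- value by one, because the root of the monochromatic tree supplies the new `b`.
treeHeight : ℕ → ℕ → ℕ
treeHeight zero    r       = 0
treeHeight (suc l) zero    = 0
treeHeight (suc l) (suc r) = suc (treeHeight l (suc r)) + suc (treeHeight (suc l) r)

-- A leaf x is compared with all nodes of the tree; on a subtree where R x is constant, x goes to
-- the front of one of the two half graphs together with the root of that subtree.
Tree⇒HalfGraph : ∀ {X Y : Set} {R : X → Y → Bool} {U : Pred X 0ℓ} {V : Pred Y 0ℓ} l r →
                 Tree R U V (treeHeight l r) →
                 HalfGraph R U V l ⊎ HalfGraph (λ x y → not (R x y)) U V r
Tree⇒HalfGraph zero    r       T = inj₁ HalfGraph-[]
Tree⇒HalfGraph (suc l) zero    T = inj₂ HalfGraph-[]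
Tree⇒HalfGraph {R = R} (suc l) (suc r) T with someLeaf T
... | x , ux with Tree-ramsey (R x) (suc (treeHeight l (suc r))) (suc (treeHeight (suc l) r)) T
...   | inj₁ (node y (vy , rxy) _ T′) with Tree⇒HalfGraph l (suc r) T′
...     | inj₁ h = inj₁ (HalfGraph-∷ x y ux vy rxy h)
...     | inj₂ h = inj₂ (HalfGraph-map (λ (u , _) → u) (λ (v , _) → v) h)
Tree⇒HalfGraph {R = R} (suc l) (suc r) T | x , ux | inj₂ (node y (vy , rxy) T′ _)
        with Tree⇒HalfGraph (suc l) r T′
...     | inj₁ h = inj₁ (HalfGraph-map (λ (u , _) → u) (λ (v , _) → v) h)
...     | inj₂ h = inj₂ (HalfGraph-∷ x y ux vy (cong not rxy)
                     (HalfGraph-map (λ (u , p) → u , cong not p) (λ (v , p) → v , cong not p) h))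

≤ᵇ-true : ∀ {m n} → m ≤ n → (m ≤ᵇ n) ≡ true
≤ᵇ-true {m} {n} = dec-true (m ≤? n)

≤ᵇ-false : ∀ {m n} → n < m → (m ≤ᵇ n) ≡ false
≤ᵇ-false {m} {n} n<m = dec-false (m ≤? n) (<⇒≱ n<m)

≤ᵇ-reverse : ∀ {k i j} → i ≤ k → j < k → not (k ∸ i ≤ᵇ k ∸ suc j) ≡ (i ≤ᵇ j)
≤ᵇ-reverse {k} {i} {j} i≤k j<k with i ≤? j
... | yes i≤j = trans (cong not (≤ᵇ-false (∸-monoʳ-< (s≤s i≤j) j<k))) (sym (≤ᵇ-true i≤j))
... | no i≰j  = trans (cong not (≤ᵇ-true (∸-monoʳ-≤ k (≰⇒> i≰j)))) (sym (≤ᵇ-false (≰⇒> i≰j)))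

-- The complement of i ≤ j is j < i, which becomes i < j when both orders are reversed. Shifting the
-- second index by one turns this into i ≤ j, at the cost of one pair.
HalfGraph-reverse : ∀ {X Y : Set} {R : X → Y → Bool} {U V} k →
                    HalfGraph (λ x y → not (R x y)) U V (suc k) → HalfGraph R U V k
HalfGraph-reverse {R = R} k (halfGraph a b u v r) =
  halfGraph (a ∘ i′) (b ∘ j′) (u ∘ i′) (v ∘ j′) λ i j → begin
    R (a (i′ i)) (b (j′ j))                ≡⟨ Bool.not-involutive _ ⟨
    not (not (R (a (i′ i)) (b (j′ j))))    ≡⟨ cong not (r (i′ i) (j′ j)) ⟩
    not (toℕ (i′ i) ≤ᵇ toℕ (j′ j))         ≡⟨ cong₂ (λ s t → not (s ≤ᵇ t)) (opposite-prop (inject₁ i)) (opposite-prop (suc j)) ⟩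
    not (k ∸ toℕ (inject₁ i) ≤ᵇ k ∸ suc (toℕ j)) ≡⟨ cong (λ s → not (k ∸ s ≤ᵇ k ∸ suc (toℕ j))) (toℕ-inject₁ i) ⟩
    not (k ∸ toℕ i ≤ᵇ k ∸ suc (toℕ j))     ≡⟨ ≤ᵇ-reverse (<⇒≤ (toℕ<n i)) (toℕ<n j) ⟩
    (toℕ i ≤ᵇ toℕ j)                       ∎
  where
  open ≡-Reasoning
  i′ j′ : Fin k → Fin (suc k)
  i′ i = opposite (inject₁ i)
  j′ j = opposite (suc j)

-- Counting

𝟙 : Bool → ℕ
𝟙 b = if b then 1 else 0

# : ∀ {n} → (Fin n → Bool) → ℕ
# f = sum (𝟙 ∘ f)

sum-mono : ∀ {n} {f g : Fin n → ℕ} → (∀ i → f i ≤ g i) → sum f ≤ sum g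
sum-mono {zero}  f≤g = z≤n
sum-mono {suc n} f≤g = +-mono-≤ (f≤g zero) (sum-mono (f≤g ∘ suc))

sum-const : ∀ n c → sum {n} (λ _ → c) ≡ n * c
sum-const zero    c = refl
sum-const (suc n) c = cong (c +_) (sum-const n c)

term≤sum : ∀ {n} (f : Fin n → ℕ) i → f i ≤ sum f
term≤sum f zero    = m≤m+n _ _
term≤sum f (suc i) = ≤-trans (term≤sum (f ∘ suc) i) (m≤n+m _ _)

𝟙≤1 : ∀ b → 𝟙 b ≤ 1
𝟙≤1 false = z≤n
𝟙≤1 true  = ≤-refl

#≤n : ∀ {n} (f : Fin n → Bool) → # f ≤ n
#≤n {n} f = begin
  # f                ≤⟨ sum-mono (𝟙≤1 ∘ f) ⟩
  sum {n} (λ _ → 1)  ≡⟨ sum-const n 1 ⟩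
  n * 1              ≡⟨ *-identityʳ n ⟩
  n                  ∎ where open ≤-Reasoning

#-full : ∀ n → # {n} (const true) ≡ n
#-full n = trans (sum-const n 1) (*-identityʳ n)

#-mono : ∀ {n} {f g : Fin n → Bool} → (∀ x → f x ≡ true → g x ≡ true) → # f ≤ # g
#-mono {f = f} {g} f⇒g = sum-mono λ x → pointwise (f x) (g x) (f⇒g x)
  where
  pointwise : ∀ b c → (b ≡ true → c ≡ true) → 𝟙 b ≤ 𝟙 c
  pointwise false c     b⇒c = z≤n
  pointwise true  true  b⇒c = ≤-refl
  pointwise true  false b⇒c with () ← b⇒c refl

#-cong : ∀ {n} {f g : Fin n → Bool} → (∀ x → f x ≡ g x) → # f ≡ # g
#-cong f≗g = sum-cong-≗ (cong 𝟙 ∘ f≗g)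

#-∨-∧ : ∀ {n} (f g : Fin n → Bool) →
        # (λ x → f x ∨ g x) + # (λ x → f x ∧ g x) ≡ # f + # g
#-∨-∧ f g = begin
  # (λ x → f x ∨ g x) + # (λ x → f x ∧ g x)      ≡⟨ ∑-distrib-+ (λ x → 𝟙 (f x ∨ g x)) (λ x → 𝟙 (f x ∧ g x)) ⟨
  sum (λ x → 𝟙 (f x ∨ g x) + 𝟙 (f x ∧ g x))      ≡⟨ sum-cong-≗ (λ x → pointwise (f x) (g x)) ⟩
  sum (λ x → 𝟙 (f x) + 𝟙 (g x))                  ≡⟨ ∑-distrib-+ (𝟙 ∘ f) (𝟙 ∘ g) ⟩
  # f + # g                                      ∎
  where
  open ≡-Reasoning
  pointwise : ∀ b c → 𝟙 (b ∨ c) + 𝟙 (b ∧ c) ≡ 𝟙 b + 𝟙 c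
  pointwise true  c = refl
  pointwise false c = +-identityʳ _

#-∪-≤ : ∀ {n} (f g : Fin n → Bool) → # (λ x → f x ∨ g x) ≤ # f + # g
#-∪-≤ f g = ≤-trans (m≤m+n _ _) (≤-reflexive (#-∨-∧ f g))

#-nonempty : ∀ {n} (f : Fin n → Bool) → 0 < # f → ∃ λ x → f x ≡ true
#-nonempty {suc n} f p with f zero in eq
... | true  = zero , eq
... | false = let (x , fx) = #-nonempty (f ∘ suc) p in suc x , fx

#-permute : ∀ {n} (f : Fin n → Bool) (π π⁻¹ : Fin n → Fin n) →
            (∀ x → π (π⁻¹ x) ≡ x) → (∀ x → π⁻¹ (π x) ≡ x) → # (f ∘ π) ≡ # f
#-permute f π π⁻¹ l r = sym (∑-permute (𝟙 ∘ f) (permutation π π⁻¹ l r))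

∣p∣≡# : ∀ {n} (p : Subset n) → ∣ p ∣ ≡ # (lookup p)
∣p∣≡# []          = refl
∣p∣≡# (true  ∷ p) = cong suc (∣p∣≡# p)
∣p∣≡# (false ∷ p) = ∣p∣≡# p

0<-factor : ∀ {n} q {m} → 0 < n → n ≤ q * m → 0 < m
0<-factor q {zero}  0<n n≤qm = contradiction (≤-trans n≤qm (≤-reflexive (*-zeroʳ q))) (<⇒≱ 0<n)
0<-factor q {suc m} _   _    = s≤s z≤n

-- If every `F x` were at least `suc b`, the weighted sum would reach `sum w * suc b`, which is too
-- large as the total weight is positive.
weightedAverage : ∀ {n} (w F : Fin n → ℕ) b → 0 < sum w →
                  sum (λ x → w x * F x) ≤ sum w * b → ∃ λ x → F x ≤ b
weightedAverage {n} w F b 0<w wF≤wb with any? (λ x → F x ≤? b)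
... | yes x≤b = x≤b
... | no  none = contradiction wF≤wb (<⇒≱ (begin-strict
  sum w * b                 <⟨ *-monoʳ-< (sum w) {{>-nonZero 0<w}} (n<1+n b) ⟩
  sum w * suc b             ≡⟨ *-comm (sum w) (suc b) ⟩
  suc b * sum w             ≡⟨ *-distribˡ-sum (suc b) w ⟩
  sum (λ x → suc b * w x)   ≤⟨ sum-mono (λ x → ≤-trans (≤-reflexive (*-comm (suc b) (w x)))
                                 (*-monoʳ-≤ (w x) (≰⇒> (λ Fx≤b → none (x , Fx≤b))))) ⟩
  sum (λ x → w x * F x)     ∎))
  where open ≤-Reasoning

fibreBound : ∀ {n m} (φ : Fin n → Fin m) b →
             (∀ c → # (λ x → does (φ x ≟ᶠ c)) ≤ b) → n ≤ m * b
fibreBound {n} {m} φ b fibre≤b = begin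
  n                                                ≡⟨ *-identityʳ n ⟨
  n * 1                                            ≡⟨ sum-const n 1 ⟨
  sum {n} (λ _ → 1)                                ≤⟨ sum-mono (λ x → ≤-trans
                                                        (≤-reflexive (cong 𝟙 (sym (dec-true (φ x ≟ᶠ φ x) refl))))
                                                        (term≤sum (λ c → 𝟙 (does (φ x ≟ᶠ c))) (φ x))) ⟩
  sum (λ x → sum (λ c → 𝟙 (does (φ x ≟ᶠ c))))      ≡⟨ ∑-comm (λ x c → 𝟙 (does (φ x ≟ᶠ c))) ⟩
  sum (λ c → # (λ x → does (φ x ≟ᶠ c)))            ≤⟨ sum-mono fibre≤b ⟩
  sum {m} (λ _ → b)                                ≡⟨ sum-const m b ⟩
  m * b                                            ∎
  where open ≤-Reasoning

⋃ : ∀ {n t} → (Fin t → Fin n → Bool) → Fin n → Bool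
⋃ {t = zero}  S x = false
⋃ {t = suc t} S x = S zero x ∨ ⋃ (S ∘ suc) x

#-∧-⋃ : ∀ {n t} (E b : ℕ) (f : Fin n → Bool) (S : Fin t → Fin n → Bool) →
        (∀ i → E * # (λ x → f x ∧ S i x) ≤ b) → E * # (λ x → f x ∧ ⋃ S x) ≤ t * b
#-∧-⋃ {n} {zero} E b f S h = ≤-reflexive (begin
  E * # (λ x → f x ∧ false)   ≡⟨ cong (E *_) (#-cong (λ x → Bool.∧-zeroʳ (f x))) ⟩
  E * # {n} (λ x → false)     ≡⟨ cong (E *_) (trans (sum-const n 0) (*-zeroʳ n)) ⟩
  E * 0                       ≡⟨ *-zeroʳ E ⟩
  0                           ∎) where open ≡-Reasoning
#-∧-⋃ {n} {suc t} E b f S h = begin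
  E * # (λ x → f x ∧ (S zero x ∨ ⋃ (S ∘ suc) x))                 ≡⟨ cong (E *_) (#-cong λ x → Bool.∧-distribˡ-∨ (f x) _ _) ⟩
  E * # (λ x → f x ∧ S zero x ∨ f x ∧ ⋃ (S ∘ suc) x)             ≤⟨ *-monoʳ-≤ E (#-∪-≤ (λ x → f x ∧ S zero x) _) ⟩
  E * (# (λ x → f x ∧ S zero x) + # (λ x → f x ∧ ⋃ (S ∘ suc) x)) ≡⟨ *-distribˡ-+ E _ _ ⟩
  E * # (λ x → f x ∧ S zero x) + E * # (λ x → f x ∧ ⋃ (S ∘ suc) x) ≤⟨ +-mono-≤ (h zero) (#-∧-⋃ E b f (S ∘ suc) (h ∘ suc)) ⟩
  b + t * b ∎ where open ≤-Reasoning

-- A Bonferroni bound with the denominator `E` cleared. The sets are added one at a time, and each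
-- new set loses at most `2 * s` to every set already present.
almostDisjoint-# : ∀ {n t} (E s : ℕ) (S : Fin t → Fin n → Bool) →
                   (∀ i → # (S i) ≡ s) →
                   (∀ i j → i ≢ j → E * # (λ x → S i x ∧ S j x) ≤ 2 * s) →
                   E * (t * s) ≤ E * # (⋃ S) + t * t * s
almostDisjoint-# {t = zero} E s S size disj = ≤-trans (≤-reflexive (*-zeroʳ E)) z≤n
almostDisjoint-# {t = suc t} E s S size disj = begin
  E * (s + t * s)                                  ≡⟨ *-distribˡ-+ E s (t * s) ⟩
  E * s + E * (t * s)                              ≤⟨ +-monoʳ-≤ (E * s) (almostDisjoint-# E s (S ∘ suc) (size ∘ suc)
                                                        λ i j i≢j → disj (suc i) (suc j) (λ { refl → i≢j refl })) ⟩
  E * s + (E * # U + t * t * s)                    ≡⟨ +-assoc (E * s) _ _ ⟨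
  E * s + E * # U + t * t * s                      ≡⟨ cong (_+ t * t * s) (begin-equality
    E * s + E * # U                                  ≡⟨ *-distribˡ-+ E s (# U) ⟨
    E * (s + # U)                                    ≡⟨ cong (λ u → E * (u + # U)) (size zero) ⟨
    E * (# (S zero) + # U)                           ≡⟨ cong (E *_) (#-∨-∧ (S zero) U) ⟨
    E * (# (⋃ S) + # (λ x → S zero x ∧ U x))         ≡⟨ *-distribˡ-+ E _ _ ⟩
    E * # (⋃ S) + E * # (λ x → S zero x ∧ U x)       ∎) ⟩
  E * # (⋃ S) + E * # (λ x → S zero x ∧ U x) + t * t * s
                                                   ≤⟨ +-monoˡ-≤ (t * t * s) (+-monoʳ-≤ (E * # (⋃ S))
                                                        (#-∧-⋃ E (2 * s) (S zero) (S ∘ suc) λ i → disj zero (suc i) λ ())) ⟩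
  -- The extra `s` completes t² + 2t to (t + 1)².
  E * # (⋃ S) + t * (2 * s) + t * t * s            ≤⟨ m≤m+n _ s ⟩
  E * # (⋃ S) + t * (2 * s) + t * t * s + s        ≡⟨ solve 3 (λ a t s → a :+ t :* (con 2 :* s) :+ t :* t :* s :+ s
                                                        := a :+ (con 1 :+ t) :* (con 1 :+ t) :* s) refl (E * # (⋃ S)) t s ⟩
  E * # (⋃ S) + suc t * suc t * s                  ∎
  where
  open ≤-Reasoning
  open +-*-Solver
  U = ⋃ (S ∘ suc)

-- Greedy choice: a pairwise inequivalent family either covers everything or leaves out a point that
-- can be added to it.
representatives : ∀ {n} {_~_ : Rel (Fin n) 0ℓ} → Decidable _~_ → (∀ {x y} → x ~ y → y ~ x) → ∀ t →
                  (Σ (Fin t → Fin n) λ g → ∀ i j → i ≢ j → ¬ (g i ~ g j))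
                  ⊎ (∃ λ t′ → t′ < t × Σ (Fin t′ → Fin n) λ g → ∀ x → ∃ λ i → x ~ g i)
representatives _~?_ symm zero = inj₁ ((λ ()) , λ ())
representatives {n} {_~_} _~?_ symm (suc t) with representatives _~?_ symm t
... | inj₂ (t′ , t′<t , g , cov) = inj₂ (t′ , m<n⇒m<1+n t′<t , g , cov)
... | inj₁ (g , ineq) with all? (λ x → any? (λ i → x ~? g i))
...   | yes cov = inj₂ (t , n<1+n t , g , cov)
...   | no ¬cov with ¬∀⟶∃¬ n (λ x → ∃ λ i → x ~ g i) (λ x → any? (λ i → x ~? g i)) ¬cov
...     | x , x≁g = inj₁ (g′ , ineq′)
  where
  g′ : Fin (suc t) → Fin n
  g′ zero    = x
  g′ (suc i) = g i
  ineq′ : ∀ i j → i ≢ j → ¬ (g′ i ~ g′ j)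
  ineq′ zero    zero    i≢j _ = i≢j refl
  ineq′ zero    (suc j) _   p = x≁g (j , p)
  ineq′ (suc i) zero    _   p = x≁g (i , symm p)
  ineq′ (suc i) (suc j) i≢j p = ineq i j (λ { refl → i≢j refl }) p

-- Growth of iterated exponentials

-- Exceeds (q + 1)², which forces two of any q + 1 translates of P to coincide, and q times the
-- bound q ^ q on the index of H.
tolerance : ℕ → ℕ
tolerance q = suc (suc q * suc q + q * q ^ q)

n<2^n : ∀ n → n < 2 ^ n
n<2^n zero    = ≤-refl
n<2^n (suc n) = begin-strict
  1 + n              <⟨ +-mono-≤-< (m^n>0 2 n) (n<2^n n) ⟩
  2 ^ n + 2 ^ n      ≡⟨ cong (2 ^ n +_) (+-identityʳ (2 ^ n)) ⟨
  2 ^ suc n          ∎ where open ≤-Reasoning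

n*n≤2^n : ∀ {n} → 4 ≤ n → n * n ≤ 2 ^ n
n*n≤2^n 4≤n = lemma (≤⇒≤′ 4≤n)
  where
  open ≤-Reasoning
  lemma : ∀ {n} → 4 ≤′ n → n * n ≤ 2 ^ n
  lemma ≤′-refl = ≤-refl
  lemma {suc n} (≤′-step 4≤n) = begin
    suc n * suc n            ≡⟨ *-suc (suc n) n ⟩
    suc n + (n + n * n)      ≡⟨ +-assoc (suc n) n (n * n) ⟨
    suc n + n + n * n        ≤⟨ +-monoˡ-≤ (n * n) (begin
      suc n + n                ≤⟨ +-monoˡ-≤ n (+-monoˡ-≤ n (≤-trans (s≤s z≤n) (≤′⇒≤ 4≤n))) ⟩
      n + n + n                ≤⟨ m≤m+n _ n ⟩
      n + n + n + n            ≡⟨ trans (*-comm n 4) (trans (cong (λ u → n + (n + (n + u))) (+-identityʳ n)) (trans (sym (+-assoc n n (n + n))) (sym (+-assoc (n + n) n n)))) ⟨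
      n * 4                    ≤⟨ *-monoʳ-≤ n (≤′⇒≤ 4≤n) ⟩
      n * n                    ∎) ⟩
    n * n + n * n            ≡⟨ cong (n * n +_) (+-identityʳ (n * n)) ⟨
    2 * (n * n)              ≤⟨ *-monoʳ-≤ 2 (lemma 4≤n) ⟩
    2 ^ suc n                ∎

q^q≤ : ∀ {q} → 2 ≤ q → q ^ q ≤ expIter 3 q
q^q≤ {q} 2≤q = begin
  q ^ q              ≤⟨ ^-monoˡ-≤ q (<⇒≤ (n<2^n q)) ⟩
  (2 ^ q) ^ q        ≡⟨ ^-*-assoc 2 q q ⟩
  -- For `q` = 3 the square of `q` exceeds `2 ^ q`, so it is first enlarged to the square of
  -- `2 ^ q`, which is at least 4.
  2 ^ (q * q)        ≤⟨ ^-monoʳ-≤ 2 (*-mono-≤ (<⇒≤ (n<2^n q)) (<⇒≤ (n<2^n q))) ⟩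
  2 ^ (2 ^ q * 2 ^ q) ≤⟨ ^-monoʳ-≤ 2 (n*n≤2^n (^-monoʳ-≤ 2 2≤q)) ⟩
  expIter 3 q        ∎ where open ≤-Reasoning

-- A splitting step divides the density by at most `tolerance q`, so the density parameter may pass
-- from `q` to `expIter 4 q`. Three exponentials absorb `q ^ q`, the fourth absorbs the products.
tolerance-growth : ∀ {q} → 2 ≤ q → tolerance q * q ≤ expIter 4 q
tolerance-growth {q} 2≤q = begin
  suc (suc q * suc q + q * q ^ q) * q   ≤⟨ *-mono-≤ (s≤s (+-mono-≤ (*-mono-≤ (n<2^n q) (n<2^n q)) (*-monoʳ-≤ q (q^q≤ 2≤q)))) q≤v ⟩
  suc (2 ^ q * 2 ^ q + q * w) * v       ≤⟨ *-monoˡ-≤ v (s≤s (+-mono-≤ (n*n≤2^n 4≤u) (*-monoˡ-≤ w q≤u))) ⟩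
  (suc v + u * w) * v                   ≤⟨ *-monoˡ-≤ v (+-monoˡ-≤ (u * w) (n<2^n v)) ⟩
  suc u * w * v                         ≤⟨ *-mono-≤ (*-monoˡ-≤ w (≤-trans (n<2^n u) v≤w)) v≤w ⟩
  -- Four factors `w` give the exponent `4 * v`, which is at most `v * v` and hence at most `w`.
  w * w * w                             ≤⟨ m≤m*n (w * w * w) w {{>-nonZero (m^n>0 2 v)}} ⟩
  w * w * w * w                         ≡⟨ *-assoc (w * w) w w ⟩
  w * w * (w * w)                       ≡⟨ cong₂ _*_ w*w w*w ⟩
  2 ^ (v + v) * 2 ^ (v + v)             ≡⟨ ^-distribˡ-+-* 2 (v + v) (v + v) ⟨
  2 ^ ((v + v) + (v + v))               ≡⟨ cong (λ x → 2 ^ ((v + v) + x)) (cong (v +_) (+-identityʳ v)) ⟨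
  2 ^ ((v + v) + 2 * v)                 ≡⟨ cong (λ x → 2 ^ (x + 2 * v)) (cong (v +_) (+-identityʳ v)) ⟨
  2 ^ (2 * v + 2 * v)                   ≡⟨ cong (λ x → 2 ^ x) (*-distribʳ-+ v 2 2) ⟨
  2 ^ (4 * v)                           ≤⟨ ^-monoʳ-≤ 2 (*-monoˡ-≤ v 4≤v) ⟩
  2 ^ (v * v)                           ≤⟨ ^-monoʳ-≤ 2 (n*n≤2^n 4≤v) ⟩
  2 ^ w                                 ∎
  where
  open ≤-Reasoning
  u = 2 ^ q
  v = 2 ^ u
  w = 2 ^ v
  q≤u = <⇒≤ (n<2^n q)
  u≤v = <⇒≤ (n<2^n u)
  v≤w = <⇒≤ (n<2^n v)
  q≤v = ≤-trans q≤u u≤v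
  4≤u = ^-monoʳ-≤ 2 2≤q
  4≤v = ≤-trans 4≤u u≤v
  w*w : w * w ≡ 2 ^ (v + v)
  w*w = sym (^-distribˡ-+-* 2 v v)

expIter-+ : ∀ a b m → expIter a (expIter b m) ≡ expIter (a + b) m
expIter-+ zero    b m = refl
expIter-+ (suc a) b m = cong (2 ^_) (expIter-+ a b m)

n≤expIter : ∀ a n → n ≤ expIter a n
n≤expIter zero    n = ≤-refl
n≤expIter (suc a) n = ≤-trans (n≤expIter a n) (<⇒≤ (n<2^n _))

expIter-monoʳ : ∀ a {m n} → m ≤ n → expIter a m ≤ expIter a n
expIter-monoʳ zero    m≤n = m≤n
expIter-monoʳ (suc a) m≤n = ^-monoʳ-≤ 2 (expIter-monoʳ a m≤n)

-- Dense good sets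

∧-true : ∀ {b c} → b ∧ c ≡ true → b ≡ true × c ≡ true
∧-true {true} {true} _ = refl , refl

does-true : ∀ {P : Set} (P? : Dec P) → does P? ≡ true → P
does-true (yes p) _ = p

does-false : ∀ {P : Set} (P? : Dec P) → does P? ≡ false → ¬ P
does-false (no ¬p) _ = ¬p

not-true : ∀ {b} → not b ≡ true → b ≡ false
not-true {false} _ = refl

module _ {n : ℕ} (R : Fin n → Fin n → Bool) where

  #⁺ #⁻ : (Fin n → Bool) → Fin n → ℕ
  #⁺ X y = # (λ x → X x ∧ R x y)
  #⁻ X y = # (λ x → X x ∧ not (R x y))

  -- The ε-good sets of Malliaris and Shelah for ε = 1/E, with a non-strict inequality and the
  -- denominator cleared.
  Good : ℕ → (Fin n → Bool) → Set
  Good E X = ∀ y → E * #⁻ X y ≤ # X ⊎ E * #⁺ X y ≤ # X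

  good? : ∀ E X y → Dec (E * #⁻ X y ≤ # X ⊎ E * #⁺ X y ≤ # X)
  good? E X y = (E * #⁻ X y ≤? # X) ⊎-dec (E * #⁺ X y ≤? # X)

  -- `m` stands for the rounded-up 1/ε and `B` for the final bound on the index. The tolerance is
  -- tied to `q`, so goodness is much finer than the density 1/q.
  record DenseGood (m B : ℕ) : Set where
    field
      q       : ℕ
      X       : Fin n → Bool
      2≤q     : 2 ≤ q
      m≤q     : m ≤ q
      q^q≤B   : q ^ q ≤ B
      dense   : n ≤ q * # X
      good    : Good (tolerance q) X

  -- If `X` is not good, some `y` splits it into two pieces, each more than a fraction
  -- 1/`tolerance q` of `X`. Both pieces are treated recursively, and two resulting trees are joined
  -- below `y`.
  denseGood⊎Tree : 0 < n → ∀ d q {m} X → 2 ≤ q → m ≤ q → n ≤ q * # X →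
                   DenseGood m (expIter (4 * d) q) ⊎ Tree R (λ x → X x ≡ true) (λ _ → ⊤) d
  denseGood⊎Tree 0<n zero q X 2≤q m≤q dense =
    let (x , Xx) = #-nonempty X (0<-factor q 0<n dense)
    in inj₂ (leaf x Xx)
  denseGood⊎Tree 0<n (suc d) q {m} X 2≤q m≤q dense with all? (good? (tolerance q) X)
  ... | yes good = inj₁ record { q = q ; X = X ; 2≤q = 2≤q ; m≤q = m≤q ; dense = dense ; good = good
                               ; q^q≤B = q^q≤B }
    where
    open ≤-Reasoning
    q^q≤B : q ^ q ≤ expIter (4 * suc d) q
    q^q≤B = begin
      q ^ q                                ≤⟨ q^q≤ 2≤q ⟩
      expIter 3 q                          ≤⟨ expIter-monoʳ 3 (n≤expIter (suc (4 * d)) q) ⟩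
      expIter 3 (expIter (suc (4 * d)) q)  ≡⟨ cong (λ a → expIter a q) (*-suc 4 d) ⟨
      expIter (4 * suc d) q                ∎
  ... | no bad with ¬∀⟶∃¬ n _ (good? (tolerance q) X) bad
  ...   | y , ¬good = combine (recurse (λ x → X x ∧ R x y) (λ h → ¬good (inj₂ h)))
                              (recurse (λ x → X x ∧ not (R x y)) (λ h → ¬good (inj₁ h)))
    where
    open ≤-Reasoning
    Q = expIter 4 q
    q≤Q = n≤expIter 4 q
    recurse : ∀ Y → ¬ (tolerance q * # Y ≤ # X) →
              DenseGood m (expIter (4 * suc d) q) ⊎ Tree R (λ x → Y x ≡ true) (λ _ → ⊤) d
    -- The `4 * d` exponentials of the recursive call start from `Q`, itself four exponentials above
    -- `q`.
    recurse Y large = subst (λ B → DenseGood m B ⊎ Tree R (λ x → Y x ≡ true) (λ _ → ⊤) d)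
      (trans (expIter-+ (4 * d) 4 q) (cong (λ a → expIter a q) (trans (+-comm (4 * d) 4) (sym (*-suc 4 d)))))
      (denseGood⊎Tree 0<n d Q Y (≤-trans 2≤q q≤Q) (≤-trans m≤q q≤Q) (begin
        n                        ≤⟨ dense ⟩
        q * # X                  ≤⟨ *-monoʳ-≤ q (<⇒≤ (≰⇒> large)) ⟩
        q * (tolerance q * # Y)  ≡⟨ *-assoc q _ _ ⟨
        q * tolerance q * # Y    ≡⟨ cong (_* # Y) (*-comm q (tolerance q)) ⟩
        tolerance q * q * # Y    ≤⟨ *-monoˡ-≤ (# Y) (tolerance-growth 2≤q) ⟩
        Q * # Y                  ∎))
    combine : DenseGood m (expIter (4 * suc d) q) ⊎ Tree R (λ x → X x ∧ R x y ≡ true) (λ _ → ⊤) d →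
              DenseGood m (expIter (4 * suc d) q) ⊎ Tree R (λ x → X x ∧ not (R x y) ≡ true) (λ _ → ⊤) d →
              DenseGood m (expIter (4 * suc d) q) ⊎ Tree R (λ x → X x ≡ true) (λ _ → ⊤) (suc d)
    combine (inj₁ g) _        = inj₁ g
    combine (inj₂ s) (inj₁ g) = inj₁ g
    combine (inj₂ s) (inj₂ t) = inj₂ (node y tt
      (Tree-map ∧-true id s)
      (Tree-map (λ p → let (Xx , Rxy) = ∧-true p in Xx , not-true Rxy) id t))

-- Left translates of a set and the kernel of the action on them

module _ {n : ℕ} (G : FiniteGroup n) where
  open FiniteGroup G
  open IsGroup isGroup using (assoc; identityˡ; identityʳ; inverseˡ; inverseʳ)

  x∙y∙y⁻¹ : ∀ x y → (x ∙ y) ∙ (y ⁻¹) ≡ x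
  x∙y∙y⁻¹ x y = trans (assoc x y (y ⁻¹)) (trans (cong (x ∙_) (inverseʳ y)) (identityʳ x))

  x∙y⁻¹∙y : ∀ x y → (x ∙ (y ⁻¹)) ∙ y ≡ x
  x∙y⁻¹∙y x y = trans (assoc x (y ⁻¹) y) (trans (cong (x ∙_) (inverseˡ y)) (identityʳ x))

  x⁻¹∙x∙y : ∀ x y → (x ⁻¹) ∙ (x ∙ y) ≡ y
  x⁻¹∙x∙y x y = trans (sym (assoc (x ⁻¹) x y)) (trans (cong (_∙ y) (inverseˡ x)) (identityˡ y))

  x∙x⁻¹∙y : ∀ x y → x ∙ ((x ⁻¹) ∙ y) ≡ y
  x∙x⁻¹∙y x y = trans (sym (assoc x (x ⁻¹) y)) (trans (cong (_∙ y) (inverseʳ x)) (identityˡ y))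

  x∙y⁻¹∙yz : ∀ x y z → (x ∙ (y ⁻¹)) ∙ (y ∙ z) ≡ x ∙ z
  x∙y⁻¹∙yz x y z = trans (assoc x (y ⁻¹) (y ∙ z)) (cong (x ∙_) (x⁻¹∙x∙y y z))

  #-translateʳ : ∀ f g → # (λ x → f (x ∙ g)) ≡ # f
  #-translateʳ f g = #-permute f (_∙ g) (_∙ (g ⁻¹)) (λ x → x∙y⁻¹∙y x g) (λ x → x∙y∙y⁻¹ x g)

  #-translateˡ : ∀ f g → # (λ x → f (g ∙ x)) ≡ # f
  #-translateˡ f g = #-permute f (g ∙_) ((g ⁻¹) ∙_) (x∙x⁻¹∙y g) (x⁻¹∙x∙y g)

  module _ (P : Fin n → Bool) where

    infix 4 _~_ _~?_
    -- Equality of the left translates g⁻¹P and h⁻¹P.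
    _~_ : Rel (Fin n) 0ℓ
    g ~ h = ∀ z → P (g ∙ z) ≡ P (h ∙ z)

    _~?_ : Decidable _~_
    g ~? h = all? (λ z → P (g ∙ z) Bool.≟ P (h ∙ z))

    ~-sym : ∀ {g h} → g ~ h → h ~ g
    ~-sym g~h z = sym (g~h z)

    -- The normal core of the left stabiliser of `P`: the elements fixing every translate g⁻¹P.
    Core : Pred (Fin n) 0ℓ
    Core k = ∀ g → g ∙ k ~ g

    core? : ∀ k → Dec (Core k)
    core? k = all? (λ g → g ∙ k ~? g)

    core : Fin n → Bool
    core k = does (core? k)

    Core-∙ : ∀ {x y} → Core x → Core y → Core (x ∙ y)
    Core-∙ {x} {y} cx cy g z = begin
      P ((g ∙ (x ∙ y)) ∙ z)   ≡⟨ cong (λ u → P (u ∙ z)) (assoc g x y) ⟨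
      P (((g ∙ x) ∙ y) ∙ z)   ≡⟨ cy (g ∙ x) z ⟩
      P ((g ∙ x) ∙ z)         ≡⟨ cx g z ⟩
      P (g ∙ z)               ∎ where open ≡-Reasoning

    Core-e : Core e
    Core-e g z = cong (λ u → P (u ∙ z)) (identityʳ g)

    Core-⁻¹ : ∀ {x} → Core x → Core (x ⁻¹)
    Core-⁻¹ {x} cx g z = begin
      P ((g ∙ (x ⁻¹)) ∙ z)         ≡⟨ cx (g ∙ (x ⁻¹)) z ⟨
      P (((g ∙ (x ⁻¹)) ∙ x) ∙ z)   ≡⟨ cong (λ u → P (u ∙ z)) (x∙y⁻¹∙y g x) ⟩
      P (g ∙ z)                    ∎ where open ≡-Reasoning

    -- Conjugation only changes the translate being tested: the hypothesis is applied at `h ∙ g` and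
    -- `(g ⁻¹) ∙ z`.
    Core-conj : ∀ g {x} → Core x → Core ((g ∙ x) ∙ (g ⁻¹))
    Core-conj g {x} cx h z = begin
      P ((h ∙ ((g ∙ x) ∙ (g ⁻¹))) ∙ z)   ≡⟨ cong (λ u → P (u ∙ z)) (assoc h (g ∙ x) (g ⁻¹)) ⟨
      P (((h ∙ (g ∙ x)) ∙ (g ⁻¹)) ∙ z)   ≡⟨ cong P (assoc _ _ _) ⟩
      P ((h ∙ (g ∙ x)) ∙ ((g ⁻¹) ∙ z))   ≡⟨ cong (λ u → P (u ∙ ((g ⁻¹) ∙ z))) (assoc h g x) ⟨
      P (((h ∙ g) ∙ x) ∙ ((g ⁻¹) ∙ z))   ≡⟨ cx (h ∙ g) ((g ⁻¹) ∙ z) ⟩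
      P ((h ∙ g) ∙ ((g ⁻¹) ∙ z))         ≡⟨ cong P (assoc h g _) ⟩
      P (h ∙ (g ∙ ((g ⁻¹) ∙ z)))         ≡⟨ cong (λ u → P (h ∙ u)) (x∙x⁻¹∙y g z) ⟩
      P (h ∙ z)                          ∎ where open ≡-Reasoning

    -- Makes every left translate of `P` a union of cosets of the core; the defining condition is
    -- used at `z` = `e`.
    translate-∙-Core : ∀ g x {k} → Core k → P (g ∙ (x ∙ k)) ≡ P (g ∙ x)
    translate-∙-Core g x {k} ck = begin
      P (g ∙ (x ∙ k))        ≡⟨ cong P (assoc g x k) ⟨
      P ((g ∙ x) ∙ k)        ≡⟨ cong P (identityʳ _) ⟨
      P (((g ∙ x) ∙ k) ∙ e)  ≡⟨ ck (g ∙ x) e ⟩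
      P ((g ∙ x) ∙ e)        ≡⟨ cong P (identityʳ _) ⟩
      P (g ∙ x)              ∎ where open ≡-Reasoning

    -- G acts on the t translates, and the kernel of this action is the core.
    core-index : ∀ {t} (g : Fin t → Fin n) → (∀ x → ∃ λ i → x ~ g i) → n ≤ t ^ t * # core
    core-index {t} g cover = fibreBound φ (# core) fibre
      where
      rep : Fin n → Fin t
      rep x = proj₁ (cover x)
      φ : Fin n → Fin (t ^ t)
      -- The self-map of the representatives induced by `x`, encoded as one of `t ^ t` numbers.
      φ x = funToFin (λ i → rep (g i ∙ x))
      same-rep : ∀ {x y} → rep x ≡ rep y → x ~ y
      same-rep {x} {y} eq z = trans (proj₂ (cover x) z)
        (trans (cong (λ i → P (g i ∙ z)) eq) (sym (proj₂ (cover y) z)))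
      φ-rep : ∀ {x y} → φ x ≡ φ y → ∀ i → g i ∙ x ~ g i ∙ y
      φ-rep {x} {y} eq i = same-rep (begin
        rep (g i ∙ x)      ≡⟨ finToFun-funToFin (λ i → rep (g i ∙ x)) i ⟨
        finToFun (φ x) i   ≡⟨ cong (λ c → finToFun {t} {t} c i) eq ⟩
        finToFun (φ y) i   ≡⟨ finToFun-funToFin (λ i → rep (g i ∙ y)) i ⟩
        rep (g i ∙ y)      ∎) where open ≡-Reasoning
      φ-kernel : ∀ {x y} → φ x ≡ φ y → Core (x ∙ (y ⁻¹))
      φ-kernel {x} {y} eq h z = begin
        P ((h ∙ (x ∙ (y ⁻¹))) ∙ z)       ≡⟨ cong P (assoc h _ z) ⟩
        P (h ∙ ((x ∙ (y ⁻¹)) ∙ z))       ≡⟨ proj₂ (cover h) _ ⟩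
        P (g i ∙ ((x ∙ (y ⁻¹)) ∙ z))     ≡⟨ cong (λ u → P (g i ∙ u)) (assoc x (y ⁻¹) z) ⟩
        P (g i ∙ (x ∙ ((y ⁻¹) ∙ z)))     ≡⟨ cong P (assoc (g i) x _) ⟨
        P ((g i ∙ x) ∙ ((y ⁻¹) ∙ z))     ≡⟨ φ-rep eq i ((y ⁻¹) ∙ z) ⟩
        P ((g i ∙ y) ∙ ((y ⁻¹) ∙ z))     ≡⟨ cong P (assoc (g i) y _) ⟩
        P (g i ∙ (y ∙ ((y ⁻¹) ∙ z)))     ≡⟨ cong (λ u → P (g i ∙ u)) (x∙x⁻¹∙y y z) ⟩
        P (g i ∙ z)                      ≡⟨ proj₂ (cover h) z ⟨
        P (h ∙ z)                        ∎
        where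
        open ≡-Reasoning
        i = rep h
      fibre : ∀ c → # (λ x → does (φ x ≟ᶠ c)) ≤ # core
      fibre c with any? (λ y → φ y ≟ᶠ c)
      ... | no none = ≤-trans (#-mono {g = const false} λ x p → contradiction (x , does-true (φ x ≟ᶠ c) p) none)
                              (≤-trans (≤-reflexive (trans (sum-const n 0) (*-zeroʳ n))) z≤n)
      -- A nonempty fibre lies in the right coset of the core through `y`.
      ... | yes (y , refl) = begin
        # (λ x → does (φ x ≟ᶠ φ y))      ≤⟨ #-mono (λ x p → dec-true (core? _) (φ-kernel (does-true (φ x ≟ᶠ φ y) p))) ⟩
        # (λ x → core (x ∙ (y ⁻¹)))      ≡⟨ #-translateʳ core (y ⁻¹) ⟩
        # core                           ∎ where open ≤-Reasoning

  -- The set of almost-containing translates and the approximation of `A`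

  module _ (A : Fin n → Bool) where

    R : Fin n → Fin n → Bool
    R x y = A (x ∙ y)

    module _ (E : ℕ) (X : Fin n → Bool) (good : Good R E X) where

      P : Fin n → Bool
      P y = does (E * #⁻ R X y ≤? # X)

      P-true : ∀ {y} → P y ≡ true → E * #⁻ R X y ≤ # X
      P-true {y} = does-true (E * #⁻ R X y ≤? # X)

      P-false : ∀ {y} → P y ≡ false → E * #⁺ R X y ≤ # X
      P-false {y} p with good y
      ... | inj₁ h = contradiction h (does-false (E * #⁻ R X y ≤? # X) p)
      ... | inj₂ h = h

      -- The right translate Xg.
      translate-X : Fin n → Fin n → Bool
      translate-X g w = X (w ∙ (g ⁻¹))

      -- Let w lie in both Xg and Xh. If wz is outside `A`, then wg⁻¹ is an exception for gz; if wz
      -- is in `A`, then wh⁻¹ is an exception for hz. Both kinds of exception are rare.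
      translates-meet : ∀ g h z → P (g ∙ z) ≡ true → P (h ∙ z) ≡ false →
                E * # (λ w → translate-X g w ∧ translate-X h w) ≤ 2 * # X
      translates-meet g h z Pgz Phz = begin
        E * # (λ w → translate-X g w ∧ translate-X h w)
          ≤⟨ *-monoʳ-≤ E (#-mono λ w → pointwise (A (w ∙ z)) (translate-X g w) (translate-X h w)) ⟩
        E * # (λ w → translate-X g w ∧ not (A (w ∙ z)) ∨ translate-X h w ∧ A (w ∙ z))
          ≤⟨ *-monoʳ-≤ E (#-∪-≤ (λ w → translate-X g w ∧ not (A (w ∙ z))) _) ⟩
        E * (# (λ w → translate-X g w ∧ not (A (w ∙ z))) + # (λ w → translate-X h w ∧ A (w ∙ z)))
          ≡⟨ cong (E *_) (cong₂ _+_
               (trans (#-cong λ w → cong (λ u → translate-X g w ∧ not (A u)) (sym (x∙y⁻¹∙yz w g z)))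
                      (#-translateʳ (λ x → X x ∧ not (A (x ∙ (g ∙ z)))) (g ⁻¹)))
               (trans (#-cong λ w → cong (λ u → translate-X h w ∧ A u) (sym (x∙y⁻¹∙yz w h z)))
                      (#-translateʳ (λ x → X x ∧ A (x ∙ (h ∙ z))) (h ⁻¹)))) ⟩
        E * (#⁻ R X (g ∙ z) + #⁺ R X (h ∙ z))
          ≡⟨ *-distribˡ-+ E _ _ ⟩
        E * #⁻ R X (g ∙ z) + E * #⁺ R X (h ∙ z)
          ≤⟨ +-mono-≤ (P-true Pgz) (P-false Phz) ⟩
        # X + # X
          ≡⟨ cong (# X +_) (+-identityʳ (# X)) ⟨
        2 * # X ∎
        where
        open ≤-Reasoning
        pointwise : ∀ a b c → b ∧ c ≡ true → b ∧ not a ∨ c ∧ a ≡ true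
        pointwise true  true  true _ = refl
        pointwise false true  true _ = refl

      ≁⇒almostDisjoint : ∀ g h → ¬ (_~_ P g h) →
                         E * # (λ w → translate-X g w ∧ translate-X h w) ≤ 2 * # X
      ≁⇒almostDisjoint g h g≁h with ¬∀⟶∃¬ n _ (λ z → P (g ∙ z) Bool.≟ P (h ∙ z)) g≁h
      ... | z , Pgz≢Phz with P (g ∙ z) in p | P (h ∙ z) in q
      ...   | true  | true  = contradiction refl Pgz≢Phz
      ...   | false | false = contradiction refl Pgz≢Phz
      ...   | true  | false = translates-meet g h z p q
      ...   | false | true  = ≤-trans
        (≤-reflexive (cong (E *_) (#-cong λ w → Bool.∧-comm (translate-X g w) (translate-X h w))))
        (translates-meet h g z q p)

      -- Otherwise q + 1 inequivalent elements give q + 1 almost disjoint translates of `X`. As G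
      -- has at most `q * # X` elements, their overlap forces E ≤ (q + 1)².
      few-translates : ∀ q → n ≤ q * # X → 0 < # X → suc q * suc q < E →
                       ∃ λ t → t ≤ q × Σ (Fin t → Fin n) λ g → ∀ x → ∃ λ i → _~_ P x (g i)
      few-translates q dense 0<#X [1+q]²<E with representatives (_~?_ P) (λ {x} {y} → ~-sym P {x} {y}) (suc q)
      ... | inj₂ (t , t<1+q , g , cover) = t , s≤s⁻¹ t<1+q , g , cover
      ... | inj₁ (g , distinct) = contradiction (*-cancelʳ-≤ E _ (# X) {{>-nonZero 0<#X}} E≤) (<⇒≱ [1+q]²<E)
        where
        open ≤-Reasoning
        E≤ : E * # X ≤ suc q * suc q * # X
        E≤ = +-cancelʳ-≤ (E * (q * # X)) _ _ (begin
          E * # X + E * (q * # X)                     ≡⟨ *-distribˡ-+ E _ _ ⟨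
          E * (suc q * # X)                           ≤⟨ almostDisjoint-# E (# X) (translate-X ∘ g)
                                                           (λ i → #-translateʳ X (g i ⁻¹))
                                                           (λ i j i≢j → ≁⇒almostDisjoint (g i) (g j) (distinct i j i≢j)) ⟩
          E * # (⋃ (translate-X ∘ g)) + suc q * suc q * # X
                                                      ≤⟨ +-monoˡ-≤ _ (*-monoʳ-≤ E (≤-trans (#≤n _) dense)) ⟩
          E * (q * # X) + suc q * suc q * # X         ≡⟨ +-comm (E * (q * # X)) _ ⟩
          suc q * suc q * # X + E * (q * # X)         ∎)

      -- `P y` is the value that A(xy) takes for almost all x in `X`, so the `xor` picks out the
      -- exceptions.
      disagreement : ∀ y → E * # (λ x → X x ∧ (A (x ∙ y) xor P y)) ≤ # X
      disagreement y with P y in p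
      ... | true  = ≤-trans (≤-reflexive (cong (E *_) (#-cong λ x → cong (X x ∧_) (xor-true (A (x ∙ y)))))) (P-true p)
        where
        xor-true : ∀ b → b xor true ≡ not b
        xor-true true  = refl
        xor-true false = refl
      ... | false = ≤-trans (≤-reflexive (cong (E *_) (#-cong λ x → cong (X x ∧_) (xor-false (A (x ∙ y)))))) (P-false p)
        where
        xor-false : ∀ b → b xor false ≡ b
        xor-false true  = refl
        xor-false false = refl

      -- Double counting: the bound holds for each fixed y, and exchanging the sums turns it into
      -- one on average over x in `X`.
      averageDisagreement : sum (λ x → 𝟙 (X x) * (E * # (λ y → A (x ∙ y) xor P y))) ≤ # X * n
      averageDisagreement = begin
        sum (λ x → 𝟙 (X x) * (E * # (λ y → A (x ∙ y) xor P y)))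
          ≡⟨ sum-cong-≗ (λ x → pull (X x) (λ y → A (x ∙ y) xor P y)) ⟩
        sum (λ x → E * # (λ y → X x ∧ (A (x ∙ y) xor P y)))
          ≡⟨ *-distribˡ-sum E (λ x → # (λ y → X x ∧ (A (x ∙ y) xor P y))) ⟨
        E * sum (λ x → # (λ y → X x ∧ (A (x ∙ y) xor P y)))
          ≡⟨ cong (E *_) (∑-comm (λ x y → 𝟙 (X x ∧ (A (x ∙ y) xor P y)))) ⟩
        E * sum (λ y → # (λ x → X x ∧ (A (x ∙ y) xor P y)))
          ≡⟨ *-distribˡ-sum E (λ y → # (λ x → X x ∧ (A (x ∙ y) xor P y))) ⟩
        sum (λ y → E * # (λ x → X x ∧ (A (x ∙ y) xor P y)))
          ≤⟨ sum-mono disagreement ⟩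
        sum {n} (λ y → # X)
          ≡⟨ sum-const n (# X) ⟩
        n * # X
          ≡⟨ *-comm n (# X) ⟩
        # X * n ∎
        where
        open ≤-Reasoning
        pull : ∀ b (f : Fin n → Bool) → 𝟙 b * (E * # f) ≡ E * # (λ y → b ∧ f y)
        pull true  f = +-identityʳ _
        pull false f = sym (trans (cong (E *_) (trans (sum-const n 0) (*-zeroʳ n))) (*-zeroʳ E))

      -- Some x does no worse than the average, and the substitution z = xy turns its row into a
      -- comparison of `A` with xP.
      approximation : 0 < # X → ∃ λ x → E * # (λ z → A z xor P ((x ⁻¹) ∙ z)) ≤ n
      approximation 0<#X =
        let (x , close) = weightedAverage (𝟙 ∘ X) (λ x → E * # (λ y → A (x ∙ y) xor P y)) n 0<#X averageDisagreement
        in x , ≤-trans (≤-reflexive (cong (E *_) (recentre x))) close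
        where
        open ≡-Reasoning
        recentre : ∀ x → # (λ z → A z xor P ((x ⁻¹) ∙ z)) ≡ # (λ y → A (x ∙ y) xor P y)
        recentre x = begin
          # (λ z → A z xor P ((x ⁻¹) ∙ z))              ≡⟨ #-translateˡ (λ z → A z xor P ((x ⁻¹) ∙ z)) x ⟨
          # (λ y → A (x ∙ y) xor P ((x ⁻¹) ∙ (x ∙ y)))  ≡⟨ #-cong (λ y → cong (λ u → A (x ∙ y) xor P u) (x⁻¹∙x∙y x y)) ⟩
          # (λ y → A (x ∙ y) xor P y)                   ∎

-- Rational bounds

open import Data.Integer using (+_; -[1+_])

-- The ceiling of 1/ε is minus the floor `f` of -1/ε, and the hypothesis is the defining inequality
-- of that floor. It forces `f` to be negative.
negatedFloor-≥ : ∀ f p d → f ℤ.* + suc p ℤ.≤ -[1+ d ] → suc d ≤ ℤ.∣ ℤ.- f ∣ * suc p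
negatedFloor-≥ (+ zero)  p d ()
negatedFloor-≥ (+ suc j) p d ()
negatedFloor-≥ -[1+ j ]  p d (ℤ.-≤- d≤) = s≤s d≤

ceilInv-≥ : (ε : ℚ) .{{_ : Positive ε}} → ℚ.denominatorℕ ε ≤ ceilInv ε * ℤ.∣ ℚ.numerator ε ∣
ceilInv-≥ (ℚ.mkℚ (+ suc p) d _) = negatedFloor-≥ (-[1+ d ] ℤ./ + suc p) p d ([n/d]*d≤n -[1+ d ] (+ suc p))

-- Here ε ≤ ½ enters; it starts the splitting at a parameter large enough for the growth estimates.
2≤ceilInv : (ε : ℚ) .{{_ : Positive ε}} → ε ≤ℚ ½ → 2 ≤ ceilInv ε
2≤ceilInv ε@(ℚ.mkℚ (+ suc p) d _) (ℚ.*≤* ε≤½) = *-cancelʳ-≤ 2 (ceilInv ε) (suc p) (begin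
  2 * suc p          ≡⟨ *-comm 2 (suc p) ⟩
  suc p * 2          ≤⟨ ℤₚ.drop‿+≤+ ε≤½ ⟩
  suc d + 0          ≡⟨ +-identityʳ (suc d) ⟩
  suc d                ≤⟨ ceilInv-≥ ε ⟩
  ceilInv ε * suc p  ∎) where open ≤-Reasoning

ceilInv-< : (ε : ℚ) .{{_ : Positive ε}} → ∀ a h → ceilInv ε * a < h →
            (+ a) / 1 <ℚ ε ℚ.* ((+ h) / 1)
-- In unnormalised rationals no fraction is reduced, so the claim is a cross-multiplied inequality
-- of integers.
ceilInv-< ε@(ℚ.mkℚ (+ suc p) d _) a h ma<h = ℚₚ.toℚᵘ-cancel-<
  (ℚᵘₚ.<-respˡ-≃ (ℚᵘₚ.≃-sym (ℚₚ.toℚᵘ-fromℚᵘ (ℚᵘ.mkℚᵘ (+ a) 0)))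
  (ℚᵘₚ.<-respʳ-≃ (ℚᵘₚ.≃-sym (ℚᵘₚ.≃-trans (ℚₚ.toℚᵘ-homo-* ε ((+ h) / 1))
                              (ℚᵘₚ.*-congˡ {ℚ.toℚᵘ ε} (ℚₚ.toℚᵘ-fromℚᵘ (ℚᵘ.mkℚᵘ (+ h) 0)))))
  (ℚᵘ.*<* (subst₂ ℤ._<_ (ℤₚ.pos-* a (suc d * 1)) (trans (ℤₚ.pos-* (suc p * h) 1) (cong (ℤ._* + 1) (ℤₚ.pos-* (suc p) h))) (ℤ.+<+ (begin-strict
    a * (suc d * 1)          ≡⟨ cong (a *_) (*-identityʳ (suc d)) ⟩
    a * suc d                  ≤⟨ *-monoʳ-≤ a (ceilInv-≥ ε) ⟩
    a * (ceilInv ε * suc p)  ≡⟨ *-assoc a (ceilInv ε) (suc p) ⟨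
    a * ceilInv ε * suc p    ≡⟨ cong (_* suc p) (*-comm a (ceilInv ε)) ⟩
    ceilInv ε * a * suc p    <⟨ *-monoˡ-< (suc p) ma<h ⟩
    h * suc p                  ≡⟨ *-comm h (suc p) ⟩
    suc p * h                  ≡⟨ *-identityʳ (suc p * h) ⟨
    suc p * h * 1            ∎))))))
  where open ≤-Reasoning

-- Passage to subsets and assembly of the approximation

lookup-△ : ∀ {n} (A D : Subset n) z → lookup (A △ D) z ≡ lookup A z xor lookup D z
lookup-△ A D z
  rewrite lookup-zipWith _∨_ z (A ∩ ∁ D) (D ∩ ∁ A)
        | lookup-zipWith _∧_ z A (∁ D) | lookup-zipWith _∧_ z D (∁ A)
        | lookup-map z not D | lookup-map z not A = pointwise (lookup A z) (lookup D z)
  where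
  pointwise : ∀ a d → a ∧ not d ∨ d ∧ not a ≡ a xor d
  pointwise true  true  = refl
  pointwise true  false = refl
  pointwise false true  = refl
  pointwise false false = refl

∣tabulate∣ : ∀ {n} (f : Fin n → Bool) → ∣ tabulate f ∣ ≡ # f
∣tabulate∣ f = trans (∣p∣≡# (tabulate f)) (#-cong (lookup∘tabulate f))

∈-tabulate⁺ : ∀ {n} (f : Fin n → Bool) {x} → f x ≡ true → x ∈ tabulate f
∈-tabulate⁺ f {x} fx = lookup⇒[]= x (tabulate f) (trans (lookup∘tabulate f x) fx)

∈-tabulate⁻ : ∀ {n} (f : Fin n → Bool) {x} → x ∈ tabulate f → f x ≡ true
∈-tabulate⁻ f {x} x∈f = trans (sym (lookup∘tabulate f x)) ([]=⇒lookup x∈f)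

Stable⇒¬HalfGraph : ∀ {n} (G : FiniteGroup n) {k} (A : Subset n) → Stable G k A →
                    ¬ HalfGraph (R G (lookup A)) (λ _ → ⊤) (λ _ → ⊤) k
Stable⇒¬HalfGraph G A stable (halfGraph a b _ _ r) = stable (a , b , λ i j → mk⇔
  (λ ab∈A → does-true (toℕ i ≤? toℕ j) (trans (sym (r i j)) ([]=⇒lookup ab∈A)))
  (λ i≤j → lookup⇒[]= _ A (trans (r i j) (dec-true (toℕ i ≤? toℕ j) i≤j))))

Fin⇒0<n : ∀ {n} → Fin n → 0 < n
Fin⇒0<n zero    = s≤s z≤n
Fin⇒0<n (suc _) = s≤s z≤n

-- The splitting starts from all of G, and stability excludes a tree of the chosen height. The
-- second size is `suc k` because reversing a complementary half graph loses one pair.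
stable⇒denseGood : ∀ {n} (G : FiniteGroup n) k (A : Subset n) → Stable G k A → ∀ {m} → 2 ≤ m →
                   DenseGood (R G (lookup A)) m (expIter (4 * treeHeight k (suc k)) m)
stable⇒denseGood {n} G k A stable {m} 2≤m
  with denseGood⊎Tree (R G (lookup A)) (Fin⇒0<n (FiniteGroup.e G)) (treeHeight k (suc k)) m (const true) 2≤m ≤-refl
         (≤-trans (m≤n*m n m {{>-nonZero (<⇒≤ 2≤m)}}) (≤-reflexive (cong (m *_) (sym (#-full n)))))
... | inj₁ dg = dg
... | inj₂ T with Tree⇒HalfGraph k (suc k) T
...   | inj₁ h = contradiction (HalfGraph-map _ _ h) (Stable⇒¬HalfGraph G A stable)
...   | inj₂ h = contradiction (HalfGraph-map _ _ (HalfGraph-reverse k h)) (Stable⇒¬HalfGraph G A stable)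

theorem4p1 : (k : ℕ) → 1 ≤ k → Σ ℕ λ C →
    ∀ (n : ℕ) (G : FiniteGroup n) (A : Subset n) → Stable G k A →
    ∀ (ε : ℚ) → .{{_ : Positive ε}} → ε ≤ℚ ½ →
    Σ (Subset n) λ H → Σ (Subset n) λ D →
    IsNormalSubgroup G H
    × (n ≤ expIter C (ceilInv ε) Data.Nat.* ∣ H ∣)
    × UnionOfCosets G H D
    × ((+ ∣ A △ D ∣) / 1 <ℚ ε Data.Rational.* ((+ ∣ H ∣) / 1))
-- Each level of splitting costs four exponentials.
theorem4p1 k _ = 4 * treeHeight k (suc k) , λ n G A stable ε ε≤½ →
  approximate G A ε (stable⇒denseGood G k A stable (2≤ceilInv ε ε≤½))
  where
  approximate : ∀ {n B} (G : FiniteGroup n) (A : Subset n) (ε : ℚ) .{{_ : Positive ε}} →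
                DenseGood (R G (lookup A)) (ceilInv ε) B →
                Σ (Subset n) λ H → Σ (Subset n) λ D →
                IsNormalSubgroup G H × (n ≤ B * ∣ H ∣) × UnionOfCosets G H D
                × ((+ ∣ A △ D ∣) / 1 <ℚ ε ℚ.* ((+ ∣ H ∣) / 1))
  approximate {n} {B} G A ε dg =
    H , D
    , ( ∈-tabulate⁺ κ (dec-true (core? G Q e) (Core-e G Q))
      , (λ x y x∈H y∈H → ∈H⁺ (Core-∙ G Q (∈H⁻ x∈H) (∈H⁻ y∈H)))
      , (λ x x∈H → ∈H⁺ (Core-⁻¹ G Q (∈H⁻ x∈H)))
      , (λ g x x∈H → ∈H⁺ (Core-conj G Q g (∈H⁻ x∈H))) )
    , ≤-trans index (*-monoˡ-≤ ∣ H ∣ q^q≤B)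
    , (λ x h x∈D h∈H → ∈-tabulate⁺ δ (trans (translate-∙-Core G Q (c ⁻¹) x (∈H⁻ h∈H)) (∈-tabulate⁻ δ x∈D)))
    , ceilInv-< ε ∣ A △ D ∣ ∣ H ∣ small
    where
    open FiniteGroup G
    open DenseGood dg
    open ≤-Reasoning
    E = tolerance q
    Q = P G (lookup A) E X good
    κ = core G Q
    H = tabulate κ
    ∈H⁺ : ∀ {x} → Core G Q x → x ∈ H
    ∈H⁺ {x} cx = ∈-tabulate⁺ κ (dec-true (core? G Q x) cx)
    ∈H⁻ : ∀ {x} → x ∈ H → Core G Q x
    ∈H⁻ {x} x∈H = does-true (core? G Q x) (∈-tabulate⁻ κ x∈H)
    0<#X : 0 < # X
    0<#X = 0<-factor q (Fin⇒0<n e) dense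
    index : n ≤ q ^ q * ∣ H ∣
    index with few-translates G (lookup A) E X good q dense 0<#X (s≤s (m≤m+n _ _))
    ... | t , t≤q , g , cover = begin
      n                ≤⟨ core-index G Q g cover ⟩
      t ^ t * # κ      ≤⟨ *-monoˡ-≤ (# κ) (≤-trans (^-monoˡ-≤ t t≤q) (^-monoʳ-≤ q {{>-nonZero (<⇒≤ 2≤q)}} t≤q)) ⟩
      q ^ q * # κ      ≡⟨ cong (q ^ q *_) (∣tabulate∣ κ) ⟨
      q ^ q * ∣ H ∣    ∎
    -- `D` is the translate cQ for an element c whose error is at most average.
    c = proj₁ (approximation G (lookup A) E X good 0<#X)
    δ : Fin n → Bool
    δ z = Q ((c ⁻¹) ∙ z)
    D = tabulate δ
    close : E * ∣ A △ D ∣ ≤ q ^ q * ∣ H ∣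
    close = begin
      E * ∣ A △ D ∣                        ≡⟨ cong (E *_) (trans (∣p∣≡# (A △ D)) (#-cong λ z →
                                                trans (lookup-△ A D z) (cong (lookup A z xor_) (lookup∘tabulate δ z)))) ⟩
      E * # (λ z → lookup A z xor δ z)     ≤⟨ proj₂ (approximation G (lookup A) E X good 0<#X) ⟩
      n                                    ≤⟨ index ⟩
      q ^ q * ∣ H ∣                        ∎
    0<∣H∣ : 0 < ∣ H ∣
    0<∣H∣ = 0<-factor (q ^ q) (Fin⇒0<n e) index
    -- `E` exceeds `q * q ^ q` and `ceilInv ε` is at most `q`, so `q ^ q` cancels. This is strict
    -- only for positive `d`; for `d` = 0 the claim is that `H` is nonempty.
    cancel : ∀ d → E * d ≤ q ^ q * ∣ H ∣ → ceilInv ε * d < ∣ H ∣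
    cancel zero    _ = ≤-trans (s≤s (≤-reflexive (*-zeroʳ (ceilInv ε)))) 0<∣H∣
    cancel d@(suc _) Ed≤ = *-cancelˡ-< (q ^ q) _ _ (begin-strict
      q ^ q * (ceilInv ε * d)   ≤⟨ *-monoʳ-≤ (q ^ q) (*-monoˡ-≤ d m≤q) ⟩
      q ^ q * (q * d)           ≡⟨ *-assoc (q ^ q) q d ⟨
      q ^ q * q * d             ≡⟨ cong (_* d) (*-comm (q ^ q) q) ⟩
      q * q ^ q * d             <⟨ *-monoˡ-< d (s≤s (m≤n+m (q * q ^ q) (suc q * suc q))) ⟩
      E * d                     ≤⟨ Ed≤ ⟩
      q ^ q * ∣ H ∣             ∎)
    small : ceilInv ε * ∣ A △ D ∣ < ∣ H ∣
    small = cancel ∣ A △ D ∣ close
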